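{- For every Boolean assignment to $x\in\{0,1\}^{2n^2}$ and to the descriptor bits of the list $A\in[n]^M$ (including lists $A$ that are unsorted or contain repetitions), the count $W(A,x)$ defined in the context satisfies $W(A,x)\in\{0,1,\dots,L\}$.
   Context: Parameters. $n=2^\ell$ is a power of two, large enough that $\ell=\log_2 n\ge5$; $M:=\lfloor n^{(\ell+1)/(\ell+2)}\rfloor$ (so $1\le M<n$) and $L:=\ell n$. Fix a bijection between $\{0,1\}^\ell$ and $[n]=\{1,\dots,n\}$, so that each $\ell$-bit string names an element of $[n]$ and a list $A\in[n]^M$ is encoded by $M\ell$ descriptor bits. Fix maps $r_1,\dots,r_\ell:[n]\times[n]\to[n]$ with the property (such maps exist) that for every $S\subseteq[n]$ with $|S|\le n^{(\ell+1)/(\ell+2)}$, $|\{(i,j)\in S\times S:\ r_k(i,j)\in S\ \forall k\in[\ell]\}|\le L$. Inputs. $x\in\{0,1\}^{2n^2}$ has coordinates $x_{i,j,b}$, $i,j\in[n]$, $b\in\{1,2\}$. Membership. For a list $A=(a_1,\dots,a_M)\in[n]^M$ (not necessarily sorted) and $i\in[n]$, $\operatorname{mem}_A(i)\in\{0,1\}$ is the output of this search: start with $\lambda=1,\mu=M+1$; while $\lambda<\mu$, let $m=\lfloor(\lambda+\mu)/2\rfloor$, and if $a_m<i$ set $\lambda:=m+1$, else set $\mu:=m$; at the end output $1$ iff $\lambda\le M$ and $a_\lambda=i$. Count. For $u\ne v$ let $E_A(u,v)=\operatorname{mem}_A(u)\operatorname{mem}_A(v)\prod_{k=1}^\ell\operatorname{mem}_A(r_k(u,v))$,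 $Z_{u,v}=(1-x_{u,v,1})(1-x_{v,v,2})$, and $W(A,x)=\sum_{u\neq v}E_A(u,v)(1-Z_{u,v})$, the sum over ordered pairs of distinct $u,v\in[n]$. -}

module Defs where

open import Data.Bool using (Bool; true; false; if_then_else_)
open import Data.Nat using (ℕ; suc; _≤_; _<_; _^_; _∸_; _/_; z≤n; s≤s; _<?_; _≤?_) renaming (_+_ to _+ℕ_; _*_ to _*ℕ_)
open import Data.Nat.Properties using (≤-trans; ≤-reflexive; <⇒≤; m≤n⇒m≤1+n; ∸-monoʳ-<; ∸-monoˡ-<; +-monoʳ-≤; +-monoˡ-<; *-comm; +-identityʳ)
open import Data.Nat.DivMod using (m*n/n≡m; /-mono-≤; m<n*o⇒m/o<n)
open import Data.Nat.Induction using (<-wellFounded)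
open import Induction.WellFounded using (Acc; acc)
open import Data.Integer using (ℤ; 0ℤ; 1ℤ; _+_; _*_; _-_)
open import Data.Fin using (Fin; zero; suc; fromℕ<)
import Data.Fin.Properties as Fin
open import Data.Fin.Subset using (Subset; _∈_; ∣_∣)
open import Data.Fin.Subset.Properties using (_∈?_)
open import Data.Vec using (Vec; lookup)
open import Data.List using (List; foldr; map; filter; length; allFin; cartesianProduct)
open import Data.Product using (_×_; _,_; Σ-syntax)
open import Relation.Nullary using (¬_; Dec; yes; no)
open import Relation.Nullary.Decidable using (¬?; _×-dec_; ⌊_⌋)
open import Relation.Binary.PropositionalEquality using (_≡_; refl; sym; trans; cong; subst)

-- s ≤ n^((ℓ+1)/(ℓ+2)), with the root cleared by raising both sides to the power ℓ+2.
AtMostPower : (n ℓ s : ℕ) → Set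
AtMostPower n ℓ s = s ^ (ℓ +ℕ 2) ≤ n ^ (ℓ +ℕ 1)

-- M = ⌊n^((ℓ+1)/(ℓ+2))⌋, i.e. M ≤ n^((ℓ+1)/(ℓ+2)) < M+1.
IsFloorPower : (n ℓ M : ℕ) → Set
IsFloorPower n ℓ M = AtMostPower n ℓ M × ¬ AtMostPower n ℓ (suc M)

-- The set [n] = {1,…,n} is represented by Fin n; only the order and equality
-- of its elements are ever used.
pairs : (n : ℕ) → List (Fin n × Fin n)
pairs n = cartesianProduct (allFin n) (allFin n)

module _ {n ℓ : ℕ} (r : Fin ℓ → Fin n → Fin n → Fin n) where

  Closed : Subset n → Fin n × Fin n → Set
  Closed S (i , j) = (i ∈ S × j ∈ S) × (∀ k → r k i j ∈ S)

  closed? : (S : Subset n) (p : Fin n × Fin n) → Dec (Closed S p)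
  closed? S (i , j) = (i ∈? S ×-dec j ∈? S) ×-dec Fin.all? (λ k → r k i j ∈? S)

  closedCount : Subset n → ℕ
  closedCount S = length (filter (closed? S) (pairs n))

  FewClosedPairs : ℕ → Set
  FewClosedPairs L = ∀ (S : Subset n) → AtMostPower n ℓ ∣ S ∣ → closedCount S ≤ L

mid : ℕ → ℕ → ℕ
mid lo hi = (lo +ℕ hi) / 2

private
  double : ∀ m → m *ℕ 2 ≡ m +ℕ m
  double m = trans (*-comm m 2) (cong (m +ℕ_) (+-identityʳ m))

lo≤mid : ∀ {lo hi} → lo < hi → lo ≤ mid lo hi
lo≤mid {lo} {hi} lo<hi =
  subst (_≤ mid lo hi) (m*n/n≡m lo 2)
    (/-mono-≤ (≤-trans (≤-reflexive (double lo)) (+-monoʳ-≤ lo (<⇒≤ lo<hi))) (≤-reflexive refl))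

mid<hi : ∀ {lo hi} → lo < hi → mid lo hi < hi
mid<hi {lo} {hi} lo<hi =
  m<n*o⇒m/o<n (subst (lo +ℕ hi <_) (sym (double hi)) (+-monoˡ-< hi lo<hi))

module _ {n M : ℕ} (A : Vec (Fin n) M) where

  -- a_m for a 1-based position m.
  entry : (m : ℕ) → 1 ≤ m → m ≤ M → Fin n
  entry (suc m) _ m<M = lookup A (fromℕ< m<M)

  -- The while loop from state (λ , μ) = (lo , hi); returns the final value of λ.
  -- The Acc argument only witnesses termination (hi ∸ lo decreases).
  search : (i : Fin n) (lo hi : ℕ) → 1 ≤ lo → hi ≤ suc M →
           Acc _<_ (hi ∸ lo) → Σ[ p ∈ ℕ ] 1 ≤ p
  search i lo hi 1≤lo hi≤1+M (acc rs) with lo <? hi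
  ... | no _ = lo , 1≤lo
  ... | yes lo<hi = body (entry m (≤-trans 1≤lo lo≤m) m≤M Fin.<? i)
    where
    m : ℕ
    m = mid lo hi
    lo≤m : lo ≤ m
    lo≤m = lo≤mid lo<hi
    m<hi : m < hi
    m<hi = mid<hi lo<hi
    m≤M : m ≤ M
    m≤M with s≤s q ← ≤-trans m<hi hi≤1+M = q
    body : ∀ {P : Set} → Dec P → Σ[ p ∈ ℕ ] 1 ≤ p
    body (yes _) = search i (suc m) hi (s≤s z≤n) hi≤1+M (rs (∸-monoʳ-< (s≤s lo≤m) m<hi))
    body (no _)  = search i lo m 1≤lo (m≤n⇒m≤1+n m≤M) (rs (∸-monoˡ-< m<hi lo≤m))

  -- Final test of the search: p ≤ M and a_p = i.
  hit : Fin n → Σ[ p ∈ ℕ ] 1 ≤ p → Bool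
  hit i (p , 1≤p) with p ≤? M
  ... | no _    = false
  ... | yes p≤M = ⌊ entry p 1≤p p≤M Fin.≟ i ⌋

  mem : Fin n → Bool
  mem i = hit i (search i 1 (suc M) (s≤s z≤n) (≤-reflexive refl) (<-wellFounded _))

bit : Bool → ℤ
bit b = if b then 1ℤ else 0ℤ

sumℤ : List ℤ → ℤ
sumℤ = foldr _+_ 0ℤ

productℤ : List ℤ → ℤ
productℤ = foldr _*_ 1ℤ

-- x u v b is x_{u,v,b}, where b = 1, 2 are represented by zero, suc zero.
Input : ℕ → Set
Input n = Fin n → Fin n → Fin 2 → Bool

module _ {n ℓ M : ℕ} (r : Fin ℓ → Fin n → Fin n → Fin n) where

  E : Vec (Fin n) M → Fin n → Fin n → ℤ
  E A u v = bit (mem A u) * bit (mem A v)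
            * productℤ (map (λ k → bit (mem A (r k u v))) (allFin ℓ))

  Z : Input n → Fin n → Fin n → ℤ
  Z x u v = (1ℤ - bit (x u v zero)) * (1ℤ - bit (x v v (suc zero)))

  W : Vec (Fin n) M → Input n → ℤ
  W A x = sumℤ (map (λ (u , v) → E A u v * (1ℤ - Z x u v))
                    (filter (λ (u , v) → ¬? (u Fin.≟ v)) (pairs n)))

{-# OPTIONS --safe #-}

-- Whatever list A is, the search only ever reports entries of A, so the set S of reported
-- elements has at most M members and the hypothesis on r applies to it. Each term of W is 0
-- or 1, and it can be 1 only at a pair that is closed for S, so W is at most the number of
-- such pairs.
module Submission where

open import Data.Bool using (Bool; true; false)
open import Data.Nat using (ℕ; suc; _≤_; _^_; _*_; _+_; _≤?_; z≤n; s≤s)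
open import Data.Nat.Properties using (≤-trans; ≤-reflexive; m≤n⇒m≤1+n; +-mono-≤; +-suc; ^-monoˡ-≤)
open import Data.Nat.Induction using (<-wellFounded)
open import Data.Integer as ℤ using (ℤ; +_; 0ℤ; 1ℤ)
import Data.Integer.Properties as ℤ
open import Data.Fin using (Fin; zero; suc; fromℕ<)
import Data.Fin.Properties as Fin
open import Data.Fin.Subset using (Subset; _∈_; ⊥; ⁅_⁆; _∪_; ∣_∣)
open import Data.Fin.Subset.Properties using (∣⊥∣≡0; ∣⁅x⁆∣≡1; x∈⁅x⁆; x∈p∪q⁺; p⊆q⇒∣p∣≤∣q∣)
open import Data.List as List using ([]; _∷_; filter; length; allFin)
open import Data.List.Relation.Unary.All using (All; []; _∷_)
open import Data.List.Relation.Unary.All.Properties using (tabulate⁻)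
open import Data.Vec using (Vec; []; _∷_; map; lookup; tabulate)
open import Data.Vec.Properties using (lookup∘tabulate; lookup⇒[]=; []=⇒lookup)
open import Data.Product using (_×_; _,_; Σ-syntax; proj₁)
open import Data.Sum using (_⊎_; inj₁; inj₂)
open import Data.Unit using (⊤; tt)
open import Function.Bundles using (_⤖_; module Bijection)
open import Level using (0ℓ)
open import Relation.Nullary using (yes; no; contradiction)
open import Relation.Nullary.Decidable using (¬?)
open import Relation.Unary using (Pred; Decidable)
open import Relation.Binary.PropositionalEquality using (_≡_; refl; sym; trans; cong₂)
open import Defs

∣p∪q∣≤∣p∣+∣q∣ : ∀ {n} (p q : Subset n) → ∣ p ∪ q ∣ ≤ ∣ p ∣ + ∣ q ∣
∣p∪q∣≤∣p∣+∣q∣ []          []          = z≤n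
∣p∪q∣≤∣p∣+∣q∣ (false ∷ p) (false ∷ q) = ∣p∪q∣≤∣p∣+∣q∣ p q
∣p∪q∣≤∣p∣+∣q∣ (false ∷ p) (true ∷ q)  =
  ≤-trans (s≤s (∣p∪q∣≤∣p∣+∣q∣ p q)) (≤-reflexive (sym (+-suc ∣ p ∣ ∣ q ∣)))
∣p∪q∣≤∣p∣+∣q∣ (true ∷ p)  (false ∷ q) = s≤s (∣p∪q∣≤∣p∣+∣q∣ p q)
∣p∪q∣≤∣p∣+∣q∣ (true ∷ p)  (true ∷ q)  =
  s≤s (≤-trans (m≤n⇒m≤1+n (∣p∪q∣≤∣p∣+∣q∣ p q)) (≤-reflexive (sym (+-suc ∣ p ∣ ∣ q ∣))))

entries : ∀ {n m} → Vec (Fin n) m → Subset n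
entries []      = ⊥
entries (a ∷ A) = ⁅ a ⁆ ∪ entries A

-- Each position of `A` adds at most one element to the union; a repeated entry adds none, hence an
-- inequality.
∣entries∣≤ : ∀ {n m} (A : Vec (Fin n) m) → ∣ entries A ∣ ≤ m
∣entries∣≤ {n} []  = ≤-reflexive (∣⊥∣≡0 n)
∣entries∣≤ (a ∷ A) =
  ≤-trans (∣p∪q∣≤∣p∣+∣q∣ ⁅ a ⁆ (entries A))
          (+-mono-≤ (≤-reflexive (∣⁅x⁆∣≡1 a)) (∣entries∣≤ A))

lookup∈entries : ∀ {n m} (A : Vec (Fin n) m) k → lookup A k ∈ entries A
lookup∈entries (a ∷ A) zero    = x∈p∪q⁺ (inj₁ (x∈⁅x⁆ a))
lookup∈entries (a ∷ A) (suc k) = x∈p∪q⁺ {p = ⁅ a ⁆} (inj₂ (lookup∈entries A k))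

-- A positive answer rests on the final equality test alone, so it is sound for any end position
-- `s`, whatever path the search took to it.
hit⇒∈entries : ∀ {n M} (A : Vec (Fin n) M) i s → hit A i s ≡ true → i ∈ entries A
hit⇒∈entries {M = M} A i (suc p , _) eq with suc p ≤? M
... | yes p<M with entry A (suc p) (s≤s z≤n) p<M Fin.≟ i
-- In every other case `hit` is `false`, against `eq`. The 1-based position `suc p` is the index `p`
-- of the vector.
...   | yes refl = lookup∈entries A (fromℕ< p<M)

-- The set S to which the hypothesis on `r` is applied. For unsorted `A` it can be smaller than
-- `entries A`, as the search may miss an entry.
members : ∀ {n M} → Vec (Fin n) M → Subset n
members A = tabulate (mem A)

mem⇒∈members : ∀ {n M} (A : Vec (Fin n) M) i → mem A i ≡ true → i ∈ members A
mem⇒∈members A i eq = lookup⇒[]= i (members A) (trans (lookup∘tabulate (mem A) i) eq)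

∈members⇒∈entries : ∀ {n M} (A : Vec (Fin n) M) {i} → i ∈ members A → i ∈ entries A
∈members⇒∈entries {M = M} A {i} i∈ =
  hit⇒∈entries A i (search A i 1 (suc M) (s≤s z≤n) (≤-reflexive refl) (<-wellFounded _))
    (trans (sym (lookup∘tabulate (mem A) i)) ([]=⇒lookup i∈))

∣members∣≤ : ∀ {n M} (A : Vec (Fin n) M) → ∣ members A ∣ ≤ M
∣members∣≤ A = ≤-trans (p⊆q⇒∣p∣≤∣q∣ (∈members⇒∈entries A)) (∣entries∣≤ A)

-- One-sided: z may vanish even when P holds.
ZeroOrOneIf : ℤ → Set → Set
ZeroOrOneIf z P = z ≡ 0ℤ ⊎ (z ≡ 1ℤ × P)

weaken : ∀ {z P Q} → (P → Q) → ZeroOrOneIf z P → ZeroOrOneIf z Q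
weaken f (inj₁ z≡0)       = inj₁ z≡0
weaken f (inj₂ (z≡1 , p)) = inj₂ (z≡1 , f p)

bit-01 : ∀ b → ZeroOrOneIf (bit b) (b ≡ true)
bit-01 false = inj₁ refl
bit-01 true  = inj₂ (refl , refl)

*-01 : ∀ {y z P Q} → ZeroOrOneIf y P → ZeroOrOneIf z Q → ZeroOrOneIf (y ℤ.* z) (P × Q)
*-01 {z = z} (inj₁ refl)    _                 = inj₁ (ℤ.*-zeroˡ z)
*-01 (inj₂ (refl , _))      (inj₁ refl)       = inj₁ refl
*-01 (inj₂ (refl , p))      (inj₂ (refl , q)) = inj₂ (refl , p , q)

product-01 : ∀ {A : Set} {f : A → ℤ} {P : Pred A 0ℓ} → (∀ a → ZeroOrOneIf (f a) (P a)) →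
             ∀ as → ZeroOrOneIf (productℤ (List.map f as)) (All P as)
product-01 f01 []       = inj₂ (refl , [])
product-01 f01 (a ∷ as) = weaken (λ (p , ps) → p ∷ ps) (*-01 (f01 a) (product-01 f01 as))

-- The condition is just `⊤`: closedness of the pair comes from the factor `E`, and here only the
-- value 0 or 1 matters.
1-Z-01 : ∀ b c → ZeroOrOneIf (1ℤ ℤ.- (1ℤ ℤ.- bit b) ℤ.* (1ℤ ℤ.- bit c)) ⊤
1-Z-01 false false = inj₁ refl
1-Z-01 false true  = inj₂ (refl , tt)
1-Z-01 true  false = inj₂ (refl , tt)
1-Z-01 true  true  = inj₂ (refl , tt)

-- Both filters run over the same list, and every term that adds 1 to the sum also passes `Q?`. A
-- natural number `w` as witness gives nonnegativity as well.
sum≤count : ∀ {A : Set} {f : A → ℤ} {P Q : Pred A 0ℓ} (P? : Decidable P) (Q? : Decidable Q) →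
            (∀ a → ZeroOrOneIf (f a) (Q a)) → ∀ as →
            Σ[ w ∈ ℕ ] (w ≤ length (filter Q? as) × sumℤ (List.map f (filter P? as)) ≡ + w)
sum≤count P? Q? f01 [] = 0 , z≤n , refl
sum≤count P? Q? f01 (a ∷ as) with sum≤count P? Q? f01 as | P? a | Q? a | f01 a
... | w , w≤ , eq | no _  | no _  | _                 = w , w≤ , eq
-- Counted but not summed: for `W` these are the closed pairs on the diagonal.
... | w , w≤ , eq | no _  | yes _ | _                 = w , m≤n⇒m≤1+n w≤ , eq
... | w , w≤ , eq | yes _ | no _  | inj₁ z            = w , w≤ , cong₂ ℤ._+_ z eq
... | w , w≤ , eq | yes _ | yes _ | inj₁ z            = w , m≤n⇒m≤1+n w≤ , cong₂ ℤ._+_ z eq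
... | w , w≤ , eq | yes _ | yes _ | inj₂ (o , _)      = suc w , s≤s w≤ , cong₂ ℤ._+_ o eq
... | w , w≤ , eq | yes _ | no ¬q | inj₂ (_ , q)      = contradiction q ¬q

E-01 : ∀ {n ℓ M} (r : Fin ℓ → Fin n → Fin n → Fin n) (A : Vec (Fin n) M) u v →
       ZeroOrOneIf (E r A u v) (Closed r (members A) (u , v))
E-01 {ℓ = ℓ} r A u v =
  -- `allFin` is a tabulation, so `tabulate⁻` turns `All` into the quantifier over `k` in `Closed`.
  weaken (λ (uv , rs) → uv , tabulate⁻ rs)
    (*-01 (*-01 (mem-01 u) (mem-01 v)) (product-01 (λ k → mem-01 (r k u v)) (allFin ℓ)))
  where
  mem-01 : ∀ i → ZeroOrOneIf (bit (mem A i)) (i ∈ members A)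
  mem-01 i = weaken (mem⇒∈members A i) (bit-01 (mem A i))

W≤closedCount : ∀ {n ℓ M} (r : Fin ℓ → Fin n → Fin n → Fin n) (A : Vec (Fin n) M) x →
                Σ[ w ∈ ℕ ] (w ≤ closedCount r (members A) × W r A x ≡ + w)
W≤closedCount {n} r A x =
  sum≤count (λ (u , v) → ¬? (u Fin.≟ v)) (closed? r (members A))
    (λ (u , v) → weaken proj₁ (*-01 (E-01 r A u v) (1-Z-01 (x u v zero) (x v v (suc zero)))))
    (pairs n)

proposition4p3 : (n ℓ M : ℕ) → n ≡ 2 ^ ℓ → 5 ≤ ℓ → IsFloorPower n ℓ M →
    (name : Vec Bool ℓ ⤖ Fin n) →
    (r : Fin ℓ → Fin n → Fin n → Fin n) → FewClosedPairs r (ℓ * n) →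
    (x : Input n) (bits : Vec (Vec Bool ℓ) M) →
    Σ[ w ∈ ℕ ] (w ≤ ℓ * n × W r (map (Bijection.to name) bits) x ≡ + w)
proposition4p3 n ℓ M _ _ (M-small , _) name r few x bits =
  let A = map (Bijection.to name) bits
      w , w≤ , W≡w = W≤closedCount r A x
      -- Raising the bound `M` on the size of S to the power `ℓ + 2` gives the root-free form of
      -- smallness that `few` asks for.
      S-small = ≤-trans (^-monoˡ-≤ (ℓ + 2) (∣members∣≤ A)) M-small
  in w , ≤-trans w≤ (few (members A) S-small) , W≡w
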